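{- Let $\vdash$ be an algebraizable logic with equivalent algebraic semantics the quasivariety $\mathbf{Y}$, and let $f$ be a selector term. Every $\mathsf{PAt}$-$f$-logic $\vdash_s$ (relative to $\vdash$) is complete with respect to its corresponding $\mathsf{PAt}$-$f$-quasivariety, i.e. for every pair $(\Gamma,\phi)$ with $\Gamma\cup\{\phi\}\subseteq Tm(\mathcal{L},\mathsf{Prop})$: $$\Gamma\vdash_s\phi \iff \mathsf{QVar}^f(\vdash_s)\vDash_f(\Gamma,\phi).$$
   Context: Let $\mathcal{L}$ be an algebraic language (function symbols with arities), $\mathsf{Prop}$ a fixed countably infinite set of variables, $Tm(\mathcal{L},\mathsf{Prop})$ the set of terms (also called formulas). A consequence relation on a set $C$ is a relation between subsets of $C$ and elements of $C$ that is reflexive ($W\vdash a$ if $a\in W$) and satisfies cut (if $W\vdash v$ for all $v\in V$ and $V\vdash a$ then $W\vdash a$); all consequence relations are assumed finitary (if $W\vdash a$ then $V\vdash a$ for some finite $V\subseteq W$). A logic is a consequence relation on $Tm(\mathcal{L},\mathsf{Prop})$ that is invariant under substitutions (endomorphisms of the term algebra). $\Lambda(\vdash)$ is the complete lattice of (finitary) logics extending $\vdash$. A quasivariety is a class of algebras closed under isomorphisms, subalgebras and reduced products. For a class $\mathbf{K}$, $\Theta\vDash_{\mathbf{K}}\gamma\approx\delta$ means that every assignment into an algebra of $\mathbf{K}$ satisfying all equations in $\Theta$ satisfies $\gamma\approx\delta$. The logic $\vdash$ is algebraizable with equivalent algebraic semantics the quasivariety $\mathbf{Y}$ (of language $\mathcal{L}$),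 witnessed by a finite set $\mu(x)$ of equations in one variable and a finite set $\Delta(x,y)$ of formulas in two variables: (1) $\Gamma\vdash\phi$ iff $\mu[\Gamma]\vDash_{\mathbf{Y}}\mu(\phi)$; (2) $\Theta\vDash_{\mathbf{Y}}\gamma\approx\delta$ iff $\Delta[\Theta]\vdash\Delta(\gamma,\delta)$; (3) $\phi\dashv\vdash\Delta[\mu(\phi)]$; (4) $\gamma\approx\delta$ and $\mu[\Delta(\gamma,\delta)]$ are $\vDash_{\mathbf{Y}}$-interderivable. Here $\mu[\Gamma]$ is the union of the sets $\mu(\psi)$ for $\psi\in\Gamma$, and $\Delta[\Theta]$ is the union of the sets $\Delta(\varepsilon,\upsilon)$ for $\varepsilon\approx\upsilon$ in $\Theta$. A unary term $f(x)$ of $\mathcal{L}$ is a selector term if it is idempotent, i.e. $f(f(x))\dashv\vdash f(x)$ (each of $f(f(x))$ and $f(x)$ is derivable from the other in $\vdash$). For a formula $\chi$, $\chi[f(\overline p)/\overline p]$ is the result of substituting $f(q)$ for each variable $q$ in $\chi$; $\Gamma[f(\overline p)/\overline p]$ is defined elementwise. For $\vdash_*\in\Lambda(\vdash)$ its $\mathsf{PAt}$-$f$-variant $\vdash_*^f$ is defined by $\Gamma\vdash_*^f\phi$ iff $\Gamma[f(\overline p)/\overline p]\vdash_*\phi[f(\overline p)/\overline p]$. A $\mathsf{PAt}$-$f$-logic is a relation of the form $\vdash_*^f$ with $\vdash_*\in\Lambda(\vdash)$. For $\mathcal{A}\in\mathbf{Y}$, $\mathcal{A}^f=\{a\in A: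 f(a)=a\}$ is the set of regular elements. A polyatomic model is a pair $(\mathcal{A},v)$ with $v:\mathsf{Prop}\to\mathcal{A}^f$. $\mathcal{A},v\vDash(\Gamma,\phi)$ means: if $\mathcal{A},v\vDash\mu[\Gamma]$ then $\mathcal{A},v\vDash\mu(\phi)$. $\mathcal{A}\vDash_f(\Gamma,\phi)$ means $\mathcal{A},v\vDash(\Gamma,\phi)$ for all polyatomic models $(\mathcal{A},v)$ on $\mathcal{A}$; $\mathbf{K}\vDash_f(\Gamma,\phi)$ means $\mathcal{A}\vDash_f(\Gamma,\phi)$ for all $\mathcal{A}\in\mathbf{K}$. The $\mathsf{PAt}$-$f$-quasivariety corresponding to $\vdash_s$ is $\mathsf{QVar}^f(\vdash_s)=\{\mathcal{A}\in\mathbf{Y}:\mathcal{A}\vDash_f(\Gamma,\phi)\text{ for all }(\Gamma,\phi)\in{\vdash_s}\}$.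
   Formalization: The selector term f is additionally required to satisfy f(f(x)) ≈ f(x) in every algebra of Y; mere interderivability f(f(x)) ⊣⊢ f(x) is not enough, as f(x) = □x in the global consequence of the modal logic KT shows. -}

module Defs where

open import Level using (Level; suc)
open import Data.Fin using (Fin)
open import Data.List using (List)
import Data.List as List
open import Data.List.Membership.Propositional renaming (_∈_ to _∈ₗ_)
open import Data.Nat using (ℕ)
open import Data.Product using (Σ; ∃; ∃-syntax; _×_; _,_; proj₁; proj₂)
open import Data.Vec using (Vec; []; _∷_)
import Data.Vec as Vec
open import Data.Vec.Relation.Binary.Pointwise.Inductive using (Pointwise; []; _∷_)
open import Data.Vec.Relation.Unary.All using (All; []; _∷_)
open import Function.Bundles using (_⇔_)
open import Function.Definitions using (Bijective)
open import Relation.Binary.Bundles using (Setoid)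
open import Relation.Binary.PropositionalEquality using (_≡_)
open import Relation.Binary.Structures using (IsEquivalence)
open import Relation.Unary using (Pred; _∈_; _⊆_; _∩_; ｛_｝)
open import Relation.Unary.Polymorphic using (U; ∅)

private
  variable
    ℓ : Level
    X Z : Set

record Language (ℓ : Level) : Set (suc ℓ) where
  field
    Symbol : Set ℓ
    arity  : Symbol → ℕ

open Language public

data Tm (L : Language ℓ) (X : Set) : Set ℓ where
  var : X → Tm L X
  op  : (g : Symbol L) → Vec (Tm L X) (arity L g) → Tm L X

Atom : Set
Atom = ℕ

Formula : Language ℓ → Set ℓ
Formula L = Tm L Atom

infixl 30 _[_] _[_]* _⟨_⟩ _⟨_∣_⟩

mutual
  _[_] : {L : Language ℓ} → Tm L X → (X → Tm L Z) → Tm L Z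
  var x   [ σ ] = σ x
  op g ts [ σ ] = op g (ts [ σ ]*)

  _[_]* : {L : Language ℓ} {n : ℕ} → Vec (Tm L X) n → (X → Tm L Z) → Vec (Tm L Z) n
  []       [ σ ]* = []
  (t ∷ ts) [ σ ]* = t [ σ ] ∷ ts [ σ ]*

UnaryTm : Language ℓ → Set ℓ
UnaryTm L = Tm L (Fin 1)

BinaryTm : Language ℓ → Set ℓ
BinaryTm L = Tm L (Fin 2)

_⟨_⟩ : {L : Language ℓ} → UnaryTm L → Tm L X → Tm L X
f ⟨ t ⟩ = f [ (λ _ → t) ]

_⟨_∣_⟩ : {L : Language ℓ} → BinaryTm L → Tm L X → Tm L X → Tm L X
d ⟨ s ∣ t ⟩ = d [ Vec.lookup (s ∷ t ∷ []) ]

infix 5 _≋_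

record Equation (L : Language ℓ) (X : Set) : Set ℓ where
  constructor _≋_
  field
    lhs rhs : Tm L X

⌊_⌋ : {C : Set ℓ} → List C → Pred C ℓ
⌊ cs ⌋ = _∈ₗ cs

image : {C D : Set ℓ} → (C → D) → Pred C ℓ → Pred D ℓ
image h W d = ∃[ c ] (c ∈ W × d ≡ h c)

Turnstile : Set ℓ → Set (suc (suc ℓ))
Turnstile {ℓ} C = Pred C ℓ → C → Set (suc ℓ)

record IsConsequence {C : Set ℓ} (_⊢_ : Turnstile C) : Set (suc ℓ) where
  field
    reflexive : ∀ {W c} → c ∈ W → W ⊢ c
    cut       : ∀ {W V c} → (∀ v → v ∈ V → W ⊢ v) → V ⊢ c → W ⊢ c
    finitary  : ∀ {W c} → W ⊢ c → ∃[ cs ] (⌊ cs ⌋ ⊆ W × ⌊ cs ⌋ ⊢ c)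

-- Endomorphisms of the term algebra are given by their values on variables.
record IsLogic {L : Language ℓ} (_⊢_ : Turnstile (Formula L)) : Set (suc ℓ) where
  field
    isConsequence : IsConsequence _⊢_
    structural    : ∀ {Γ φ} (σ : Atom → Formula L) → Γ ⊢ φ → image _[ σ ] Γ ⊢ φ [ σ ]

  open IsConsequence isConsequence public

record Λ {L : Language ℓ} (_⊢_ _⊢⋆_ : Turnstile (Formula L)) : Set (suc ℓ) where
  field
    isLogic : IsLogic _⊢⋆_
    extends : ∀ {Γ φ} → Γ ⊢ φ → Γ ⊢⋆ φ

-- Equality of elements is a setoid equality, so that quotients, and in
-- particular reduced products, exist.
record Algebra (L : Language ℓ) : Set (suc ℓ) where
  infix 4 _≈_
  field
    Carrier       : Set ℓ
    _≈_           : Carrier → Carrier → Set ℓ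
    isEquivalence : IsEquivalence _≈_
    ⟦_⟧           : (g : Symbol L) → Vec Carrier (arity L g) → Carrier
    ⟦⟧-cong       : ∀ g {as bs} → Pointwise _≈_ as bs → ⟦ g ⟧ as ≈ ⟦ g ⟧ bs

  open IsEquivalence isEquivalence public

open Algebra using (Carrier)

module _ {L : Language ℓ} (A : Algebra L) where
  open Algebra A hiding (Carrier)

  mutual
    eval : (X → Carrier A) → Tm L X → Carrier A
    eval v (var x)   = v x
    eval v (op g ts) = ⟦ g ⟧ (eval* v ts)

    eval* : {n : ℕ} → (X → Carrier A) → Vec (Tm L X) n → Vec (Carrier A) n
    eval* v []       = []
    eval* v (t ∷ ts) = eval v t ∷ eval* v ts

infix 4 _,_⊨_

_,_⊨_ : {L : Language ℓ} (A : Algebra L) → (X → Carrier A) → Equation L X → Set ℓ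
A , v ⊨ (s ≋ t) = eval A v s ≈ eval A v t
  where open Algebra A hiding (Carrier)

record IsIsomorphism {L : Language ℓ} (A B : Algebra L) (h : Carrier A → Carrier B) : Set ℓ where
  private
    module A = Algebra A
    module B = Algebra B
  field
    cong      : ∀ {x y} → x A.≈ y → h x B.≈ h y
    homo      : ∀ g as → h (A.⟦ g ⟧ as) B.≈ B.⟦ g ⟧ (Vec.map h as)
    bijective : Bijective A._≈_ B._≈_ h

record IsSubuniverse {L : Language ℓ} (A : Algebra L) (P : Pred (Carrier A) ℓ) : Set ℓ where
  open Algebra A hiding (Carrier)
  field
    resp   : ∀ {x y} → x ≈ y → x ∈ P → y ∈ P
    closed : ∀ g {as} → All P as → ⟦ g ⟧ as ∈ P

module _ {L : Language ℓ} (A : Algebra L) {P : Pred (Carrier A) ℓ} (sub : IsSubuniverse A P) where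
  open Algebra A hiding (Carrier)
  open IsSubuniverse sub

  private
    all : ∀ {n} (as : Vec (Σ (Carrier A) P) n) → All P (Vec.map proj₁ as)
    all []             = []
    all ((_ , p) ∷ as) = p ∷ all as

    pointwise : ∀ {n} {as bs : Vec (Σ (Carrier A) P) n} →
                Pointwise (λ x y → proj₁ x ≈ proj₁ y) as bs →
                Pointwise _≈_ (Vec.map proj₁ as) (Vec.map proj₁ bs)
    pointwise []       = []
    pointwise (e ∷ es) = e ∷ pointwise es

  subalgebra : Algebra L
  subalgebra = record
    { Carrier       = Σ (Carrier A) P
    ; _≈_           = λ x y → proj₁ x ≈ proj₁ y
    ; isEquivalence = record { refl = refl ; sym = sym ; trans = trans }
    ; ⟦_⟧           = λ g as → ⟦ g ⟧ (Vec.map proj₁ as) , closed g (all as)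
    ; ⟦⟧-cong       = λ g es → ⟦⟧-cong g (pointwise es)
    }

-- The improper filter is allowed; its reduced product is the trivial algebra,
-- which is also the product of the empty family.
record IsFilter {I : Set ℓ} (F : Pred (Pred I ℓ) ℓ) : Set (suc ℓ) where
  field
    whole  : U ∈ F
    inter  : ∀ {S T} → S ∈ F → T ∈ F → S ∩ T ∈ F
    upward : ∀ {S T} → S ⊆ T → S ∈ F → T ∈ F

module _ {L : Language ℓ} {I : Set ℓ} (A : I → Algebra L)
         {F : Pred (Pred I ℓ) ℓ} (filter : IsFilter F) where
  private
    module A i = Algebra (A i)
    open IsFilter filter

    C : Set ℓ
    C = ∀ i → Carrier (A i)

    _≈F_ : C → C → Set ℓ
    x ≈F y = F (λ i → A._≈_ i (x i) (y i))

    pointwise : ∀ {n} {as bs : Vec C n} → Pointwise _≈F_ as bs →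
                F (λ i → Pointwise (A._≈_ i) (Vec.map (λ x → x i) as) (Vec.map (λ x → x i) bs))
    pointwise []       = upward (λ _ → []) whole
    pointwise (e ∷ es) = upward (λ (p , ps) → p ∷ ps) (inter e (pointwise es))

  reducedProduct : Algebra L
  reducedProduct = record
    { Carrier       = C
    ; _≈_           = _≈F_
    ; isEquivalence = record
      { refl  = upward (λ {i} _ → A.refl i) whole
      ; sym   = upward (λ {i} → A.sym i)
      ; trans = λ p q → upward (λ {i} (e , e′) → A.trans i e e′) (inter p q)
      }
    ; ⟦_⟧           = λ g as i → A.⟦_⟧ i g (Vec.map (λ x → x i) as)
    ; ⟦⟧-cong       = λ g es → upward (λ {i} → A.⟦⟧-cong i g) (pointwise es)
    }

Class : Language ℓ → Set (suc (suc ℓ))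
Class {ℓ} L = Pred (Algebra L) (suc ℓ)

record IsQuasivariety {L : Language ℓ} (K : Class L) : Set (suc ℓ) where
  field
    isomorphisms    : ∀ {A B} h → IsIsomorphism A B h → A ∈ K → B ∈ K
    subalgebras     : ∀ {A P} (sub : IsSubuniverse A P) → A ∈ K → subalgebra A sub ∈ K
    reducedProducts : ∀ {I : Set ℓ} {A : I → Algebra L} {F} (filter : IsFilter F) →
                      (∀ i → A i ∈ K) → reducedProduct A filter ∈ K

infix 4 _⊨[_]_

_⊨[_]_ : {L : Language ℓ} → Pred (Equation L Atom) ℓ → Class L → Equation L Atom → Set (suc ℓ)
Θ ⊨[ K ] e = ∀ A → A ∈ K → ∀ v → (∀ e′ → e′ ∈ Θ → A , v ⊨ e′) → A , v ⊨ e

module _ {L : Language ℓ} where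

  infix 30 _⟪_⟫ _⟪_⟫ₑ _⟦_⟧ₛ _⟦_⟧ₑ

  _⟪_⟫ : List (Equation L (Fin 1)) → Formula L → List (Equation L Atom)
  μ ⟪ φ ⟫ = List.map (λ (s ≋ t) → s ⟨ φ ⟩ ≋ t ⟨ φ ⟩) μ

  _⟪_⟫ₑ : List (BinaryTm L) → Equation L Atom → List (Formula L)
  Δ ⟪ γ ≋ δ ⟫ₑ = List.map (_⟨ γ ∣ δ ⟩) Δ

  _⟦_⟧ₛ : List (Equation L (Fin 1)) → Pred (Formula L) ℓ → Pred (Equation L Atom) ℓ
  (μ ⟦ Γ ⟧ₛ) e = ∃[ ψ ] (ψ ∈ Γ × e ∈ₗ μ ⟪ ψ ⟫)

  _⟦_⟧ₑ : List (BinaryTm L) → Pred (Equation L Atom) ℓ → Pred (Formula L) ℓ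
  (Δ ⟦ Θ ⟧ₑ) φ = ∃[ e ] (e ∈ Θ × φ ∈ₗ Δ ⟪ e ⟫ₑ)

record IsAlgebraizable {L : Language ℓ} (_⊢_ : Turnstile (Formula L)) (Y : Class L)
                       (μ : List (Equation L (Fin 1))) (Δ : List (BinaryTm L)) : Set (suc ℓ) where
  field
    ⊢⇔⊨    : ∀ Γ φ → Γ ⊢ φ ⇔ (∀ e → e ∈ₗ μ ⟪ φ ⟫ → μ ⟦ Γ ⟧ₛ ⊨[ Y ] e)
    ⊨⇔⊢    : ∀ Θ e → Θ ⊨[ Y ] e ⇔ (∀ χ → χ ∈ₗ Δ ⟪ e ⟫ₑ → Δ ⟦ Θ ⟧ₑ ⊢ χ)
    φ⊢Δμφ  : ∀ φ χ → χ ∈ Δ ⟦ ⌊ μ ⟪ φ ⟫ ⌋ ⟧ₑ → ｛ φ ｝ ⊢ χ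
    Δμφ⊢φ  : ∀ φ → Δ ⟦ ⌊ μ ⟪ φ ⟫ ⌋ ⟧ₑ ⊢ φ
    e⊨μΔe  : ∀ e e′ → e′ ∈ μ ⟦ ⌊ Δ ⟪ e ⟫ₑ ⌋ ⟧ₛ → ｛ e ｝ ⊨[ Y ] e′
    μΔe⊨e  : ∀ e → μ ⟦ ⌊ Δ ⟪ e ⟫ₑ ⌋ ⟧ₛ ⊨[ Y ] e

-- The idempotence of f is equational: f(f(x)) and f(x) agree in every algebra
-- of Y.  Interderivability f(f(x)) ⊣⊢ f(x) follows from this but does not
-- imply it, and alone does not give completeness: in the global consequence
-- of the modal logic KT, f(x) = □x is interderivable with f(f(x)), and
-- p → □p holds whenever p takes a value a = □a, yet □p → □□p is no theorem.
record IsSelector {L : Language ℓ} (_⊢_ : Turnstile (Formula L)) (Y : Class L)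
                  (f : UnaryTm L) : Set (suc ℓ) where
  field
    ffx⊢fx     : ｛ f ⟨ f ⟨ var 0 ⟩ ⟩ ｝ ⊢ f ⟨ var 0 ⟩
    fx⊢ffx     : ｛ f ⟨ var 0 ⟩ ｝ ⊢ f ⟨ f ⟨ var 0 ⟩ ⟩
    idempotent : ∅ ⊨[ Y ] f ⟨ f ⟨ var 0 ⟩ ⟩ ≋ f ⟨ var 0 ⟩

infixl 30 _[_/p]

_[_/p] : {L : Language ℓ} → Formula L → UnaryTm L → Formula L
χ [ f /p] = χ [ (λ q → f ⟨ var q ⟩) ]

variant : {L : Language ℓ} → UnaryTm L → Turnstile (Formula L) → Turnstile (Formula L)
variant f _⊢⋆_ Γ φ = image _[ f /p] Γ ⊢⋆ φ [ f /p]

IsPAtLogic : {L : Language ℓ} → Turnstile (Formula L) → UnaryTm L →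
             Turnstile (Formula L) → Set (suc (suc ℓ))
IsPAtLogic _⊢_ f _⊢ₛ_ = ∃[ ⊢⋆ ] (Λ _⊢_ ⊢⋆ × (∀ Γ φ → Γ ⊢ₛ φ ⇔ variant f ⊢⋆ Γ φ))

Regular : {L : Language ℓ} → UnaryTm L → (A : Algebra L) → Pred (Carrier A) ℓ
Regular f A a = eval A (λ _ → a) f ≈ a
  where open Algebra A hiding (Carrier)

module _ {L : Language ℓ} (μ : List (Equation L (Fin 1))) (f : UnaryTm L) where

  AlgebraValid : Algebra L → Pred (Formula L) ℓ → Formula L → Set ℓ
  AlgebraValid A Γ φ =
    ∀ (v : Atom → Carrier A) → (∀ p → v p ∈ Regular f A) →
    (∀ e → e ∈ μ ⟦ Γ ⟧ₛ → A , v ⊨ e) → (∀ e → e ∈ₗ μ ⟪ φ ⟫ → A , v ⊨ e)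

  ClassValid : Class L → Pred (Formula L) ℓ → Formula L → Set (suc ℓ)
  ClassValid K Γ φ = ∀ A → A ∈ K → AlgebraValid A Γ φ

  QVar : Class L → Turnstile (Formula L) → Class L
  QVar Y _⊢ₛ_ A = A ∈ Y × (∀ Γ φ → Γ ⊢ₛ φ → AlgebraValid A Γ φ)

{-# OPTIONS --safe #-}

-- Suppose ⊢⋆ extends ⊢ and Γ ⊢ₛ φ means Γ[f(p)/p] ⊢⋆ φ[f(p)/p].  Let T be the
-- ⊢⋆-theory generated by Γ[f(p)/p].  The equations e with Δ(e) ⊆ T are closed under
-- ⊨[ Y ], so they are exactly the equations true at some v in a product A of
-- algebras of Y: one factor refutes each equation outside the set.  By
-- algebraizability, μ(χ) holds at v iff χ ∈ T.  In the subalgebra generated by v,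
-- a regular valuation comes from a substitution σ, and regularity gives χ[f(p)/p][σ]
-- the value of χ; so structurality of ⊢⋆ puts this subalgebra in QVar.  The
-- valuation p ↦ f(v p), regular because f is idempotent, shows φ[f(p)/p] ∈ T.
module Submission where

open import Defs
open import Axiom.ExcludedMiddle using (ExcludedMiddle)
open import Data.Fin using (Fin)
open import Data.List using (List)
open import Data.List.Membership.Propositional using () renaming (_∈_ to _∈ₗ_)
open import Data.List.Membership.Propositional.Properties using (∈-map⁺; ∈-map⁻)
open import Data.Product using (Σ; ∃-syntax; _×_; _,_; proj₁; proj₂)
open import Data.Vec using (Vec; []; _∷_)
import Data.Vec as Vec
open import Data.Vec.Relation.Binary.Pointwise.Inductive using (Pointwise; []; _∷_)
open import Data.Vec.Relation.Unary.All using (All; []; _∷_)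
open import Function using (_∘_)
open import Function.Bundles using (_⇔_; mk⇔; Equivalence)
open import Level using (Level; Lift; lift; lower; suc)
open import Relation.Binary.PropositionalEquality as ≡ using (_≡_)
open import Relation.Nullary using (¬_)
open import Relation.Nullary.Decidable using (True; toWitness; fromWitness; decidable-stable; map′)
open import Relation.Unary using (Pred; _∈_)

open Algebra using (Carrier)
open Equivalence using (to; from)

private
  variable
    ℓ : Level
    L : Language ℓ
    X Z : Set

-- Evaluation, substitution and homomorphisms.

module _ (A : Algebra L) where
  open Algebra A hiding (Carrier)

  module _ {v : Z → Carrier A} {w : X → Carrier A} {σ : X → Tm L Z}
           (v∘σ≈w : ∀ x → eval A v (σ x) ≈ w x) where

    -- Since `w` need only agree with `eval A v ∘ σ` up to `≈`, the same induction can later absorb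
    -- the regularity of a valuation.
    eval-[]  : ∀ t → eval A v (t [ σ ]) ≈ eval A w t
    eval*-[] : ∀ {n} (ts : Vec (Tm L X) n) →
               Pointwise _≈_ (eval* A v (ts [ σ ]*)) (eval* A w ts)

    eval-[] (var x)   = v∘σ≈w x
    eval-[] (op g ts) = ⟦⟧-cong g (eval*-[] ts)

    eval*-[] []       = []
    eval*-[] (t ∷ ts) = eval-[] t ∷ eval*-[] ts

  eval-⟨⟩ : ∀ {v : Z → Carrier A} {a s} → eval A v s ≈ a →
            ∀ t → eval A v (t ⟨ s ⟩) ≈ eval A (λ _ → a) t
  eval-⟨⟩ s≈a = eval-[] (λ _ → s≈a)

module _ (A B : Algebra L) (h : Carrier A → Carrier B)
         (homo : ∀ g as → h (Algebra.⟦_⟧ A g as) ≡ Algebra.⟦_⟧ B g (Vec.map h as))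
         (v : X → Carrier A) where

  -- Stated with `≡`, because projections out of subalgebras and products commute with the
  -- operations definitionally.
  eval-homo  : ∀ t → h (eval A v t) ≡ eval B (h ∘ v) t
  eval*-homo : ∀ {n} (ts : Vec (Tm L X) n) → Vec.map h (eval* A v ts) ≡ eval* B (h ∘ v) ts

  eval-homo (var x)   = ≡.refl
  eval-homo (op g ts) = ≡.trans (homo g _) (≡.cong (Algebra.⟦_⟧ B g) (eval*-homo ts))

  eval*-homo []       = ≡.refl
  eval*-homo (t ∷ ts) = ≡.cong₂ _∷_ (eval-homo t) (eval*-homo ts)

-- Satisfaction in subalgebras and products.

module _ (A : Algebra L) {P : Pred (Carrier A) _} (sub : IsSubuniverse A P) where

  eval-subalgebra : ∀ (w : X → Σ (Carrier A) P) t →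
                    proj₁ (eval (subalgebra A sub) w t) ≡ eval A (proj₁ ∘ w) t
  eval-subalgebra = eval-homo (subalgebra A sub) A proj₁ (λ _ _ → ≡.refl)

  ⊨-subalgebra : ∀ (w : X → Σ (Carrier A) P) e →
                 subalgebra A sub , w ⊨ e ⇔ A , proj₁ ∘ w ⊨ e
  ⊨-subalgebra w (s ≋ t) = mk⇔
    (≡.subst₂ (Algebra._≈_ A) (eval-subalgebra w s) (eval-subalgebra w t))
    (≡.subst₂ (Algebra._≈_ A) (≡.sym (eval-subalgebra w s)) (≡.sym (eval-subalgebra w t)))

module _ {L : Language ℓ} {I : Set ℓ} (A : I → Algebra L) where

  wholeFilter : IsFilter {I = I} (λ S → ∀ i → S i)
  wholeFilter = record
    { whole  = λ _ → _
    ; inter  = λ p q i → p i , q i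
    ; upward = λ S⊆T p i → S⊆T (p i)
    }

  product : Algebra L
  product = reducedProduct A wholeFilter

  ⊨-product : ∀ (v : X → Carrier product) e →
              product , v ⊨ e ⇔ (∀ i → A i , (λ x → v x i) ⊨ e)
  ⊨-product v (s ≋ t) = mk⇔
    (λ p i → ≡.subst₂ (Algebra._≈_ (A i)) (eval-π i s) (eval-π i t) (p i))
    (λ p i → ≡.subst₂ (Algebra._≈_ (A i)) (≡.sym (eval-π i s)) (≡.sym (eval-π i t)) (p i))
    where
    eval-π : ∀ i t → eval product v t i ≡ eval (A i) (λ x → v x i) t
    eval-π i = eval-homo product (A i) (λ x → x i) (λ _ _ → ≡.refl) v

  product-∈ : ∀ {K : Class L} → IsQuasivariety K → (∀ i → A i ∈ K) → product ∈ K
  product-∈ isQ = IsQuasivariety.reducedProducts isQ wholeFilter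

module _ {L : Language ℓ} (A : Algebra L) (v : Atom → Carrier A) where
  open Algebra A hiding (Carrier)

  -- Keeping the term as data lets a valuation into the generated subalgebra be read as a
  -- substitution.
  Generated : Pred (Carrier A) ℓ
  Generated a = ∃[ t ] eval A v t ≈ a

  generated : IsSubuniverse A Generated
  generated = record
    { resp   = λ x≈y (t , t≈x) → t , trans t≈x x≈y
    ; closed = λ g ps → op g (terms ps) , ⟦⟧-cong g (eval*-terms ps)
    }
    where
    terms : ∀ {n} {as : Vec _ n} → All Generated as → Vec (Formula L) n
    terms []             = []
    terms ((t , _) ∷ ps) = t ∷ terms ps

    eval*-terms : ∀ {n} {as : Vec _ n} (ps : All Generated as) →
                  Pointwise _≈_ (eval* A v (terms ps)) as
    eval*-terms []               = []
    eval*-terms ((_ , t≈a) ∷ ps) = t≈a ∷ eval*-terms ps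

em-lower : ExcludedMiddle (suc ℓ) → ExcludedMiddle ℓ
em-lower {ℓ} em {P} = map′ lower lift (em {Lift (suc ℓ) P})

-- Generic models of closed sets of equations and of theories.

module _ {L : Language ℓ} (em : ExcludedMiddle (suc ℓ)) {K : Class L}
         (isQ : IsQuasivariety K) where

  generic-model : (Θ : Pred (Equation L Atom) ℓ) → (∀ e → Θ ⊨[ K ] e → e ∈ Θ) →
                  ∃[ A ] (A ∈ K × ∃[ v ] (∀ e → A , v ⊨ e ⇔ e ∈ Θ))
  generic-model Θ closed =
    product A , product-∈ A isQ A∈K , v , λ e → mk⇔
      (λ A⊨e → decidable-stable (em-lower em) λ e∉Θ →
        proj₂ (proj₂ (proj₂ (proj₂ (refute (e , e∉Θ)))))
              (to (⊨-product A v e) A⊨e (e , e∉Θ)))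
      (λ e∈Θ → from (⊨-product A v e) λ i →
        proj₁ (proj₂ (proj₂ (proj₂ (refute i)))) e e∈Θ)
    where
    I : Set ℓ
    I = ∃[ e ] ¬ (e ∈ Θ)

    Refutation : Equation L Atom → Set (suc ℓ)
    Refutation e =
      ∃[ A ] (A ∈ K × ∃[ v ] ((∀ e′ → e′ ∈ Θ → A , v ⊨ e′) × ¬ (A , v ⊨ e)))

    -- Excluded middle produces an actual witness for each index, so the factors form a family
    -- without a separate choice principle.
    refute : ∀ ((e , _) : I) → Refutation e
    refute (e , e∉Θ) = decidable-stable em λ irrefutable →
      e∉Θ (closed e λ A A∈K v A⊨Θ → decidable-stable (em-lower em) λ A⊭e →
        irrefutable (A , A∈K , v , A⊨Θ , A⊭e))

    A : I → Algebra L
    A i = proj₁ (refute i)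

    A∈K : ∀ i → A i ∈ K
    A∈K i = proj₁ (proj₂ (refute i))

    v : Atom → Carrier (product A)
    v p i = proj₁ (proj₂ (proj₂ (refute i))) p

module _ {L : Language ℓ} (μ : List (Equation L (Fin 1))) where

  Designated : (A : Algebra L) → (Atom → Carrier A) → Pred (Formula L) ℓ
  Designated A v φ = ∀ e → e ∈ₗ μ ⟪ φ ⟫ → A , v ⊨ e

  -- The equations of `μ` have a single variable, so only the value of the formula matters.
  Designated-resp-≈ : ∀ (A : Algebra L) {v w : Atom → Carrier A} {φ ψ} →
                      Algebra._≈_ A (eval A v φ) (eval A w ψ) →
                      Designated A v φ → Designated A w ψ
  Designated-resp-≈ A φ≈ψ A⊨μφ e e∈ with (s ≋ t) , s≋t∈μ , ≡.refl ← ∈-map⁻ _ e∈ =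
    trans (eval-⟨⟩ A refl s)
      (trans (sym (eval-⟨⟩ A φ≈ψ s))
        (trans (A⊨μφ _ (∈-map⁺ _ s≋t∈μ))
          (trans (eval-⟨⟩ A φ≈ψ t) (sym (eval-⟨⟩ A refl t)))))
    where open Algebra A hiding (Carrier)

module _ {L : Language ℓ} (em : ExcludedMiddle (suc ℓ)) {_⊢_ : Turnstile (Formula L)}
         (isLogic : IsLogic _⊢_) {Y : Class L} (isQ : IsQuasivariety Y)
         {μ : List (Equation L (Fin 1))} {Δ : List (BinaryTm L)}
         (alg : IsAlgebraizable _⊢_ Y μ Δ) where
  open IsLogic isLogic
  open IsAlgebraizable alg

  -- Take the equations `e` with `Δ(e)` inside `T`. A formula is interderivable with `Δ[μ(χ)]`, so
  -- `μ(χ)` lies in this set iff `χ ∈ T`.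
  theory-model : (T : Pred (Formula L) ℓ) → (∀ {χ} → T ⊢ χ → χ ∈ T) →
                 ∃[ A ] (A ∈ Y × ∃[ v ] (∀ χ → Designated μ A v χ ⇔ χ ∈ T))
  theory-model T closed =
    let A , A∈Y , v , A⊨e⇔e∈Θ = generic-model em isQ Θ Θ-closed in
    A , A∈Y , v , λ χ → mk⇔
      (λ A⊨μχ → closed (cut
        (λ { ψ (e , e∈μχ , ψ∈Δe) → reflexive (to (A⊨e⇔e∈Θ e) (A⊨μχ e e∈μχ) ψ ψ∈Δe) })
        (Δμφ⊢φ χ)))
      (λ χ∈T e e∈μχ → from (A⊨e⇔e∈Θ e) λ ψ ψ∈Δe →
        closed (cut (λ { _ ≡.refl → reflexive χ∈T }) (φ⊢Δμφ χ ψ (e , e∈μχ , ψ∈Δe))))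
    where
    Θ : Pred (Equation L Atom) ℓ
    Θ e = ∀ χ → χ ∈ₗ Δ ⟪ e ⟫ₑ → χ ∈ T

    Θ-closed : ∀ e → Θ ⊨[ Y ] e → e ∈ Θ
    Θ-closed e Θ⊨e χ χ∈Δe =
      closed (cut (λ { ψ (_ , d∈Θ , ψ∈Δd) → reflexive (d∈Θ ψ ψ∈Δd) })
                  (to (⊨⇔⊢ Θ e) Θ⊨e χ χ∈Δe))

  -- Completeness of the variant.

  module _ {f : UnaryTm L} (isSel : IsSelector _⊢_ Y f)
           {_⊢⋆_ : Turnstile (Formula L)} (Λ⋆ : Λ _⊢_ _⊢⋆_) where
    open Λ Λ⋆ renaming (isLogic to isLogic⋆)
    module ⊢⋆ = IsLogic isLogic⋆

    variant-complete : ∀ Γ φ → ClassValid μ f (QVar μ f Y (variant f _⊢⋆_)) Γ φ →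
                       variant f _⊢⋆_ Γ φ
    variant-complete Γ φ valid =
      -- Validity is used in `B` at `f∘v`; in `A`, the value of `φ` there is that of `φ [ f /p]` at
      -- `v`.
      toWitness (lower (to (A⊨μχ⇔χ∈T (φ [ f /p]))
        (Designated-resp-≈ μ A (sym (eval-f φ)) λ e e∈μφ →
          to (⊨-subalgebra A sub f∘v e)
            (valid B B∈QVar f∘v f∘v-regular B⊨μΓ e e∈μφ))))
      where
      -- Excluded middle brings the theory from level suc ℓ down to level ℓ, as
      -- predicates on formulas require.
      T : Pred (Formula L) ℓ
      T χ = Lift ℓ (True (em {image _[ f /p] Γ ⊢⋆ χ}))

      -- The model needs only closure under `⊢`; membership of `B` in the quasivariety needs closure
      -- under `⊢⋆`.
      T-closed⋆ : ∀ {χ} → T ⊢⋆ χ → χ ∈ T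
      T-closed⋆ T⊢χ = lift (fromWitness (⊢⋆.cut (λ _ ψ∈T → toWitness (lower ψ∈T)) T⊢χ))

      model : ∃[ A ] (A ∈ Y × ∃[ v ] (∀ χ → Designated μ A v χ ⇔ χ ∈ T))
      model = theory-model T (λ T⊢χ → T-closed⋆ (extends T⊢χ))

      A : Algebra L
      A = proj₁ model

      A∈Y : A ∈ Y
      A∈Y = proj₁ (proj₂ model)

      v : Atom → Carrier A
      v = proj₁ (proj₂ (proj₂ model))

      A⊨μχ⇔χ∈T : ∀ χ → Designated μ A v χ ⇔ χ ∈ T
      A⊨μχ⇔χ∈T = proj₂ (proj₂ (proj₂ model))

      open Algebra A hiding (Carrier)

      sub : IsSubuniverse A (Generated A v)
      sub = generated A v

      B : Algebra L
      B = subalgebra A sub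

      B∈QVar : B ∈ QVar μ f Y (variant f _⊢⋆_)
      B∈QVar = IsQuasivariety.subalgebras isQ sub A∈Y , λ Ξ ψ Ξ⊢ψ w w-regular B⊨μΞ →
        let
          -- The terms naming the values of `w`, available because `B` is generated by `v`.
          σ : Atom → Formula L
          σ p = proj₁ (proj₂ (w p))

          eval-f-σ : ∀ χ → eval A v (χ [ f /p] [ σ ]) ≈ eval A (proj₁ ∘ w) χ
          eval-f-σ χ = trans
            (eval-[] A (λ p → proj₂ (proj₂ (w p))) (χ [ f /p]))
            -- Each `f ⟨ var p ⟩` takes the value `f(w p)`, which is `w p` by regularity.
            (eval-[] A (λ p → trans (eval-⟨⟩ A refl f)
              (≡.subst (_≈ proj₁ (w p)) (eval-subalgebra A sub _ f) (w-regular p))) χ)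

          ψ∈T : ψ [ f /p] [ σ ] ∈ T
          -- Structurality applies `σ` to the derivation of `ψ [ f /p]`; truth of `μ[Ξ]` at `w` puts
          -- each substituted premise in `T`.
          ψ∈T = T-closed⋆ (⊢⋆.cut
            (λ { _ (_ , (χ , χ∈Ξ , ≡.refl) , ≡.refl) → ⊢⋆.reflexive
              (to (A⊨μχ⇔χ∈T _) (Designated-resp-≈ μ A (sym (eval-f-σ χ)) λ e e∈μχ →
                to (⊨-subalgebra A sub w e) (B⊨μΞ e (χ , χ∈Ξ , e∈μχ)))) })
            (⊢⋆.structural σ Ξ⊢ψ))
        in λ e e∈μψ → from (⊨-subalgebra A sub w e)
          (Designated-resp-≈ μ A (eval-f-σ ψ) (from (A⊨μχ⇔χ∈T _) ψ∈T) e e∈μψ)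

      f∘v : Atom → Carrier B
      f∘v p = eval A v (f ⟨ var p ⟩) , f ⟨ var p ⟩ , refl

      eval-f : ∀ χ → eval A v (χ [ f /p]) ≈ eval A (proj₁ ∘ f∘v) χ
      eval-f = eval-[] A (λ _ → refl)

      f∘v-regular : ∀ p → f∘v p ∈ Regular f B
      f∘v-regular p = ≡.subst (_≈ proj₁ (f∘v p)) (≡.sym (eval-subalgebra A sub _ f))
        (trans (sym (eval-⟨⟩ A f-at-p f))
          -- Idempotence speaks of the variable 0 only; the constant valuation at `v p` carries it
          -- over to `p`.
          (trans (IsSelector.idempotent isSel A A∈Y (λ _ → v p) λ _ ()) f-at-p))
        where
        f-at-p : eval A (λ _ → v p) (f ⟨ var 0 ⟩) ≈ proj₁ (f∘v p)
        f-at-p = trans (eval-⟨⟩ A refl f) (sym (eval-⟨⟩ A refl f))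

      B⊨μΓ : ∀ e → e ∈ μ ⟦ Γ ⟧ₛ → B , f∘v ⊨ e
      B⊨μΓ e (ψ , ψ∈Γ , e∈μψ) = from (⊨-subalgebra A sub f∘v e)
        (Designated-resp-≈ μ A (eval-f ψ)
          (from (A⊨μχ⇔χ∈T _) (lift (fromWitness (⊢⋆.reflexive (ψ , ψ∈Γ , ≡.refl)))))
          e e∈μψ)

theorem3p26 : ∀ {ℓ} → ExcludedMiddle (suc ℓ) →
    (L : Language ℓ) (_⊢_ : Turnstile (Formula L)) → IsLogic _⊢_ →
    (Y : Class L) → IsQuasivariety Y →
    (μ : List (Equation L (Fin 1))) (Δ : List (BinaryTm L)) → IsAlgebraizable _⊢_ Y μ Δ →
    (f : UnaryTm L) → IsSelector _⊢_ Y f →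
    (_⊢ₛ_ : Turnstile (Formula L)) → IsPAtLogic _⊢_ f _⊢ₛ_ →
    (Γ : Pred (Formula L) ℓ) (φ : Formula L) →
    (Γ ⊢ₛ φ) ⇔ ClassValid μ f (QVar μ f Y _⊢ₛ_) Γ φ
theorem3p26 em L _⊢_ isLogic Y isQ μ Δ alg f isSel _⊢ₛ_ (_⊢⋆_ , Λ⋆ , ⊢ₛ⇔variant) Γ φ = mk⇔
  (λ Γ⊢φ A (_ , A⊨⊢ₛ) → A⊨⊢ₛ Γ φ Γ⊢φ)
  -- `⊢ₛ` is only logically equivalent to the variant, so membership in `QVar` is translated between
  -- the two.
  (λ valid → from (⊢ₛ⇔variant Γ φ) (variant-complete em isLogic isQ alg isSel Λ⋆ Γ φ
    λ A (A∈Y , A⊨variant) → valid A (A∈Y , λ Ξ ψ Ξ⊢ψ →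
      A⊨variant Ξ ψ (to (⊢ₛ⇔variant Ξ ψ) Ξ⊢ψ))))
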